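{- For all integers $k \ge 1$ and $n \ge 2\left\lceil\frac{k}{2}\right\rceil+2$, $$\mathrm{sat}^*(n,K_{1,k}\cup K_2)\le \binom{2\left\lceil\frac{k}{2}\right\rceil+2}{2}.$$
   Context: All graphs are finite and simple; $K_{1,k}$ is the star with $k$ edges and $\cup$ denotes vertex-disjoint union. An edge-colouring of a graph is proper if incident edges receive different colours, and a subgraph is rainbow if all of its edges receive pairwise distinct colours. A graph $G$ is properly rainbow $H$-saturated if (1) there is a proper edge-colouring of $G$ (with any set of colours) containing no rainbow copy of $H$, and (2) for every edge $e$ of the complement $\overline{G}$, every proper edge-colouring of $G+e$ contains a rainbow copy of $H$. The proper rainbow saturation number $\mathrm{sat}^*(n,H)$ is the minimum number of edges in an $n$-vertex properly rainbow $H$-saturated graph. -}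

module Defs where

open import Data.Bool using (Bool; true; false; not; _∨_; T)
open import Data.Bool.Properties using (T?)
open import Data.Fin using (Fin; zero; suc; splitAt; _≟_; _<?_)
open import Data.List using (List; length; filter; cartesianProduct; allFin)
open import Data.Nat using (ℕ; _+_; _≤_)
open import Data.Product using (Σ-syntax; ∃-syntax; _×_; _,_; uncurry)
open import Data.Sum using (_⊎_; inj₁; inj₂)
open import Function.Bundles using (mk⇔)
open import Function.Definitions using (Injective)
open import Relation.Binary.PropositionalEquality
  using (_≡_; _≢_; refl; sym; trans; cong; cong₂)
open import Relation.Nullary using (¬_; Dec; does; _×-dec_; _⊎-dec_)
open import Relation.Nullary.Decidable using (does-⇔; dec-true; dec-false)

record Graph (n : ℕ) : Set where
  field
    adj        : Fin n → Fin n → Bool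
    adj-sym    : ∀ u v → adj u v ≡ adj v u
    adj-irrefl : ∀ u → adj u u ≡ false

  Adj : Fin n → Fin n → Set
  Adj u v = T (adj u v)

open Graph public

-- Each edge is listed once, as the pair with its smaller endpoint first.
edges : ∀ {n} → Graph n → List (Fin n × Fin n)
edges {n} G = filter (uncurry λ u v → (u <? v) ×-dec T? (adj G u v))
                     (cartesianProduct (allFin n) (allFin n))

edgeCount : ∀ {n} → Graph n → ℕ
edgeCount G = length (edges G)

-- Equality of the unordered pairs {u , v} and {x , y}.
SameEdge : ∀ {n} → Fin n → Fin n → Fin n → Fin n → Set
SameEdge u v x y = (u ≡ x × v ≡ y) ⊎ (u ≡ y × v ≡ x)

sameEdge? : ∀ {n} (u v x y : Fin n) → Dec (SameEdge u v x y)
sameEdge? u v x y = ((u ≟ x) ×-dec (v ≟ y)) ⊎-dec ((u ≟ y) ×-dec (v ≟ x))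

addEdge : ∀ {n} (G : Graph n) (x y : Fin n) → x ≢ y → Graph n
addEdge {n} G x y x≢y = record
  { adj        = λ u v → adj G u v ∨ does (sameEdge? u v x y)
  ; adj-sym    = λ u v → cong₂ _∨_ (adj-sym G u v)
                     (does-⇔ (mk⇔ flip flip) (sameEdge? u v x y) (sameEdge? v u x y))
  ; adj-irrefl = λ u → cong₂ _∨_ (adj-irrefl G u) (dec-false (sameEdge? u u x y) no-loop)
  }
  where
  flip : ∀ {u v} → SameEdge u v x y → SameEdge v u x y
  flip (inj₁ (p , q)) = inj₂ (q , p)
  flip (inj₂ (p , q)) = inj₁ (q , p)

  no-loop : ∀ {u} → ¬ SameEdge u u x y
  no-loop (inj₁ (p , q)) = x≢y (trans (sym p) q)
  no-loop (inj₂ (p , q)) = x≢y (trans (sym q) p)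

complete : ∀ n → Graph n
complete n = record
  { adj        = λ u v → not (does (u ≟ v))
  ; adj-sym    = λ u v → cong not (does-⇔ (mk⇔ sym sym) (u ≟ v) (v ≟ u))
  ; adj-irrefl = λ u → cong not (dec-true (u ≟ u) refl)
  }

-- K_{1,k}, with centre zero.
star : ∀ k → Graph (1 + k)
star k = record { adj = a ; adj-sym = s ; adj-irrefl = i }
  where
  a : Fin (1 + k) → Fin (1 + k) → Bool
  a zero    (suc _) = true
  a (suc _) zero    = true
  a zero    zero    = false
  a (suc _) (suc _) = false

  s : ∀ u v → a u v ≡ a v u
  s zero    zero    = refl
  s zero    (suc _) = refl
  s (suc _) zero    = refl
  s (suc _) (suc _) = refl

  i : ∀ u → a u u ≡ false
  i zero    = refl
  i (suc _) = refl

-- Vertex-disjoint union.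
infixr 6 _∪_
_∪_ : ∀ {m n} → Graph m → Graph n → Graph (m + n)
_∪_ {m} {n} G H = record
  { adj        = λ u v → a (splitAt m u) (splitAt m v)
  ; adj-sym    = λ u v → s (splitAt m u) (splitAt m v)
  ; adj-irrefl = λ u → i (splitAt m u)
  }
  where
  a : Fin m ⊎ Fin n → Fin m ⊎ Fin n → Bool
  a (inj₁ u) (inj₁ v) = adj G u v
  a (inj₂ u) (inj₂ v) = adj H u v
  a (inj₁ _) (inj₂ _) = false
  a (inj₂ _) (inj₁ _) = false

  s : ∀ u v → a u v ≡ a v u
  s (inj₁ u) (inj₁ v) = adj-sym G u v
  s (inj₂ u) (inj₂ v) = adj-sym H u v
  s (inj₁ _) (inj₂ _) = refl
  s (inj₂ _) (inj₁ _) = refl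

  i : ∀ u → a u u ≡ false
  i (inj₁ u) = adj-irrefl G u
  i (inj₂ u) = adj-irrefl H u

-- Colours are named by natural numbers, with no bound on how many are used;
-- a finite graph never needs other colour names.  Only the values of colour
-- on adjacent pairs matter.
record EdgeColouring {n} (G : Graph n) : Set where
  field
    colour     : Fin n → Fin n → ℕ
    colour-sym : ∀ {u v} → Adj G u v → colour u v ≡ colour v u

open EdgeColouring public

Proper : ∀ {n} {G : Graph n} → EdgeColouring G → Set
Proper {G = G} c = ∀ {u v w} → Adj G u v → Adj G u w → v ≢ w →
                   colour c u v ≢ colour c u w

-- A copy of H in G is a not necessarily induced subgraph isomorphic to H.
record Copy {h n} (H : Graph h) (G : Graph n) : Set where
  field
    embed     : Fin h → Fin n
    injective : Injective _≡_ _≡_ embed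
    edge      : ∀ {u v} → Adj H u v → Adj G (embed u) (embed v)

open Copy public

Rainbow : ∀ {h n} {H : Graph h} {G : Graph n} → EdgeColouring G → Copy H G → Set
Rainbow {H = H} c f = ∀ {u v x y} → Adj H u v → Adj H x y → ¬ SameEdge u v x y →
  colour c (embed f u) (embed f v) ≢ colour c (embed f x) (embed f y)

HasRainbowCopy : ∀ {h n} (H : Graph h) {G : Graph n} → EdgeColouring G → Set
HasRainbowCopy H {G} c = Σ[ f ∈ Copy H G ] Rainbow c f

record ProperlyRainbowSaturated {h n} (H : Graph h) (G : Graph n) : Set where
  field
    avoidable : Σ[ c ∈ EdgeColouring G ] Proper c × ¬ HasRainbowCopy H c
    saturated : ∀ x y (x≢y : x ≢ y) → ¬ Adj G x y →
                (c : EdgeColouring (addEdge G x y x≢y)) → Proper c →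
                HasRainbowCopy H c

-- IsSat* n H s says that sat*(n,H) is defined and equal to s.
record IsSat* {h} (n : ℕ) (H : Graph h) (s : ℕ) : Set where
  field
    attained : ∃[ G ] (ProperlyRainbowSaturated {n = n} H G × edgeCount G ≡ s)
    minimal  : (G : Graph n) → ProperlyRainbowSaturated H G → s ≤ edgeCount G

{-# OPTIONS --safe #-}
module Submission where

-- Put t = ⌈k/2⌉ and N = 2t + 1, so that k + 1 ≤ N ≤ k + 2, and let G be the complete graph on
-- N + 1 vertices together with isolated vertices.
--
-- Colour the clique properly with N colours (round robin). In a rainbow copy of K_{1,k} ∪ K_2
-- with centre v and isolated edge ab, the colours of ab and of the k + 2 edges from v to the
-- other vertices of the copy would be pairwise distinct, but k + 3 > N.
--
-- A new edge xy has an end outside the clique, so N clique vertices avoid both x and y. In a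
-- proper colouring the edges among them coloured like xy form a matching, which misses a
-- vertex v as N is odd; v with k of its N − 1 neighbours and xy is a rainbow copy.
--
-- For the minimum to exist constructively, saturation has to be decidable: a colouring may be
-- compressed to finitely many colours, after which every quantifier ranges over a finite set.

open import Defs
open import Data.Bool using (Bool; true; false; T; _∨_; if_then_else_) renaming (_≟_ to _≟ᵇ_)
open import Data.Bool.Properties using (T?; T-∨)
open import Data.Fin as Fin using (Fin; zero; suc; toℕ; combine; _≟_; _<?_; splitAt; join; fromℕ<; inject≤; punchIn; _↑ˡ_; _↑ʳ_)
open import Data.Fin.Properties as Fin using (all?; any?; toℕ-injective; combine-injective; ¬∀⟶∃¬; injective⇒≤; fromℕ<-injective; splitAt-↑ˡ; splitAt-↑ʳ; splitAt⁻¹-↑ˡ; splitAt⁻¹-↑ʳ; join-splitAt; inject≤-injective; toℕ-inject≤; toℕ-fromℕ<; toℕ<n; punchIn-injective; punchInᵢ≢i)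
open import Data.List using (List; length; filter; cartesianProduct; tabulate; map; _++_; allFin)
open import Data.List.Properties using (filter-≐; length-++; filter-++; map-tabulate)
open import Data.Nat as ℕ using (ℕ; zero; suc; _+_; _*_; _∸_; _%_; _<_; _≤_; _≥_; z≤n; s≤s; ⌈_/2⌉; ⌊_/2⌋)
open import Data.Nat.Combinatorics using (_C_; nCk+nC[k+1]≡[n+1]C[k+1]; nC1≡n)
open import Data.Nat.Divisibility using (_∣_; _∣0; ∣m∣n⇒∣m+n; ∣m+n∣m⇒∣n; m∣m*n; ∣1⇒≡1)
open import Data.Nat.DivMod using (%-distribˡ-+; %-distribˡ-*; m<n⇒m%n≡m; [m+n]%n≡m%n; [m+kn]%n≡m%n; m%n<n)
open import Data.Nat.Induction using (<-rec)
open import Data.Nat.Properties as ℕ using (anyUpTo?; ≮⇒≥; ≤-trans; ≤-reflexive)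
open import Algebra.Properties.CommutativeMonoid.Sum ℕ.+-0-commutativeMonoid using (sum; sum-cong-≗; ∑-distrib-+; sum-replicate-zero)
open import Data.Nat.Tactic.RingSolver using (solve-∀)
open import Data.Product using (Σ; Σ-syntax; ∃; ∃-syntax; _×_; _,_; proj₁; proj₂)
open import Data.Sum using (_⊎_; inj₁; inj₂)
open import Data.Unit using (tt)
open import Data.Vec.Functional using ([]; _∷_; head; tail)
open import Data.Vec.Functional.Relation.Binary.Pointwise.Properties using () renaming (setoid to vectorSetoid)
open import Function using (_∘_; id)
open import Function.Bundles using (_⇔_; mk⇔; Equivalence)
open import Function.Definitions using (Injective)
open import Level using (0ℓ)
open import Relation.Binary using (Setoid; _Respects_)
open import Relation.Binary.PropositionalEquality
open import Relation.Nullary using (¬_; Dec; yes; no; contradiction; ¬?; _×-dec_; _→-dec_; does)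
open import Relation.Nullary.Decidable using (map′; does-⇔; dec-false; decidable-stable)
open import Relation.Unary using (Decidable)

open Equivalence using (to; from)

-- Decidability of saturation

-- Predicates have to respect the setoid equality because a search through functions meets each one
-- only up to pointwise equality.
Searchable : Setoid 0ℓ 0ℓ → Set₁
Searchable S = ∀ {P : Setoid.Carrier S → Set} → P Respects Setoid._≈_ S → Decidable P → Dec (∃ P)

searchable-Fin : ∀ n → Searchable (setoid (Fin n))
searchable-Fin n _ P? = any? P?

searchable-Bool : Searchable (setoid Bool)
searchable-Bool _ P? with P? true | P? false
... | yes p | _     = yes (true , p)
... | no _  | yes p = yes (false , p)
... | no ¬p | no ¬q = no λ { (true , p) → ¬p p ; (false , q) → ¬q q }

-- Induction on the length: search for a head such that the search for a matching tail succeeds. A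
-- function is only pointwise equal to its head consed onto its tail, whence the uses of `resp`.
searchable-vector : ∀ {S} → Searchable S → ∀ n → Searchable (vectorSetoid S n)
searchable-vector search zero resp P? =
  map′ ([] ,_) (λ (_ , p) → resp (λ ()) p) (P? [])
searchable-vector {S} search (suc n) {P} resp P? =
  map′ (λ (x , f , p) → x ∷ f , p)
       (λ (f , p) → head f , tail f , resp (λ { zero → ≈-refl ; (suc _) → ≈-refl }) p)
       (search (λ x≈y (f , p) → f , resp (λ { zero → x≈y ; (suc _) → ≈-refl }) p)
               λ x → searchable-vector {S} search n
                       (λ f≈g → resp λ { zero → ≈-refl ; (suc i) → f≈g i })
                       (λ f → P? (x ∷ f)))
  where open Setoid S using () renaming (refl to ≈-refl)

-- Equality ignores the proofs of `R`, so graphs and colourings can be searched as matrices subject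
-- to a side condition.
subsetoid : (S : Setoid 0ℓ 0ℓ) → (Setoid.Carrier S → Set) → Setoid 0ℓ 0ℓ
subsetoid S R = record
  { Carrier       = Σ Carrier R
  ; _≈_           = λ (x , _) (y , _) → x ≈ y
  ; isEquivalence = record
      { refl = Setoid.refl S ; sym = Setoid.sym S ; trans = Setoid.trans S }
  }
  where open Setoid S using (Carrier; _≈_)

searchable-sub : ∀ {S R} → R Respects Setoid._≈_ S → Decidable R →
                 Searchable S → Searchable (subsetoid S R)
searchable-sub {S} {R} R-resp R? search {P} P-resp P? =
  map′ (λ (x , r , p) → (x , r) , p) (λ ((x , r) , p) → x , r , p)
       (search (λ x≈y (r , p) → R-resp x≈y r , P-resp x≈y p) within?)
  where
  within? : Decidable λ x → Σ[ r ∈ R x ] P (x , r)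
  within? x with R? x
  ... | no ¬r = no (¬r ∘ proj₁)
  -- Testing a single proof `r` is enough: by reflexivity of the equality, `P` passes between any
  -- two proofs of `R x`.
  ... | yes r = map′ (r ,_) (λ (_ , p) → P-resp (Setoid.refl S) p) (P? (x , r))

matrixSetoid : Set → ℕ → Setoid 0ℓ 0ℓ
matrixSetoid A n = vectorSetoid (vectorSetoid (setoid A) n) n

searchable-matrix : ∀ {A} → Searchable (setoid A) → ∀ n → Searchable (matrixSetoid A n)
searchable-matrix {A} search n =
  searchable-vector {vectorSetoid (setoid A) n} (searchable-vector {setoid A} search n) n

-- Well-founded descent: either a smaller witness exists and the search continues from it, or `m` is
-- already the minimum.
least : ∀ {P : ℕ → Set} → Decidable P → ∀ {m} → P m → ∃[ s ] (P s × ∀ {t} → P t → s ≤ t)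
least {P} P? = <-rec (λ m → P m → Least) step _
  where
  Least = ∃[ s ] (P s × ∀ {t} → P t → s ≤ t)

  step : ∀ m → (∀ {j} → j < m → P j → Least) → P m → Least
  step m rec p with anyUpTo? P? m
  ... | yes (_ , j<m , q) = rec j<m q
  ... | no none           = m , p , λ q → ≮⇒≥ λ t<m → none (_ , t<m , q)

module _ {h n : ℕ} (H : Graph h) {G : Graph n} (c : EdgeColouring G) where

  private
    IsRainbowCopy : (Fin h → Fin n) → Set
    IsRainbowCopy f =
      (∀ u v → f u ≡ f v → u ≡ v) ×
      (∀ u v → Adj H u v → Adj G (f u) (f v)) ×
      (∀ u v x y → Adj H u v → Adj H x y → ¬ SameEdge u v x y →
         colour c (f u) (f v) ≢ colour c (f x) (f y))

    respects : ∀ {f g} → f ≗ g → IsRainbowCopy f → IsRainbowCopy g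
    respects e (inj , edg , rain) =
      (λ u v q → inj u v (trans (e u) (trans q (sym (e v))))) ,
      (λ u v a → subst₂ (Adj G) (e u) (e v) (edg u v a)) ,
      (λ u v x y a b ≁ q → rain u v x y a b ≁
        (trans (cong₂ (colour c) (e u) (e v)) (trans q (sym (cong₂ (colour c) (e x) (e y))))))

    isRainbowCopy? : Decidable IsRainbowCopy
    isRainbowCopy? f =
      (all? λ u → all? λ v → (f u ≟ f v) →-dec (u ≟ v)) ×-dec
      (all? λ u → all? λ v → T? (adj H u v) →-dec T? (adj G (f u) (f v))) ×-dec
      (all? λ u → all? λ v → all? λ x → all? λ y →
        T? (adj H u v) →-dec (T? (adj H x y) →-dec (¬? (sameEdge? u v x y) →-dec
          ¬? (colour c (f u) (f v) ℕ.≟ colour c (f x) (f y)))))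

  hasRainbowCopy? : Dec (HasRainbowCopy H c)
  hasRainbowCopy? =
    map′ (λ (f , inj , edg , rain) →
            record { embed = f ; injective = inj _ _ ; edge = edg _ _ } , rain _ _ _ _)
         (λ (f , rain) → embed f , (λ _ _ → injective f) , (λ _ _ → edge f) , λ _ _ _ _ → rain)
         (searchable-vector {setoid (Fin n)} (searchable-Fin n) h respects isRainbowCopy?)

proper? : ∀ {n} {G : Graph n} (c : EdgeColouring G) → Dec (Proper c)
proper? {G = G} c = map′ (λ p → p _ _ _) (λ p _ _ _ → p)
  (all? λ u → all? λ v → all? λ w →
    T? (adj G u v) →-dec (T? (adj G u w) →-dec (¬? (v ≟ w) →-dec
      ¬? (colour c u v ℕ.≟ colour c u w))))

Avoiding : ∀ {h n} (H : Graph h) {G : Graph n} → EdgeColouring G → Set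
Avoiding H c = Proper c × ¬ HasRainbowCopy H c

Avoidable : ∀ {h n} → Graph h → Graph n → Set
Avoidable H G = Σ[ c ∈ EdgeColouring G ] Avoiding H c

infix 4 _≈ᴳ_ _≈ᶜ_

_≈ᴳ_ : ∀ {n} → Graph n → Graph n → Set
G ≈ᴳ G′ = ∀ u v → adj G u v ≡ adj G′ u v

-- Equality of the partitions into colour classes.
_≈ᶜ_ : ∀ {n} {G G′ : Graph n} → EdgeColouring G → EdgeColouring G′ → Set
c ≈ᶜ c′ = ∀ {u v x y} → colour c u v ≡ colour c x y ⇔ colour c′ u v ≡ colour c′ x y

-- Properness and rainbowness only test colours for equality, so they depend on the partition into
-- colour classes alone.
avoiding-resp : ∀ {h n} {H : Graph h} {G G′ : Graph n}
                {c : EdgeColouring G} {c′ : EdgeColouring G′} →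
                G ≈ᴳ G′ → c ≈ᶜ c′ → Avoiding H c → Avoiding H c′
avoiding-resp G≈ c≈ (proper , none) =
  (λ a b v≢w → proper (subst T (sym (G≈ _ _)) a) (subst T (sym (G≈ _ _)) b) v≢w ∘ from c≈) ,
  λ (f , rain) → none
    ( record { embed = embed f ; injective = injective f
             ; edge = λ a → subst T (sym (G≈ _ _)) (edge f a) }
    , λ a b ≁ → rain a b ≁ ∘ to c≈ )

avoidable-resp : ∀ {h n} {H : Graph h} {G G′ : Graph n} → G ≈ᴳ G′ → Avoidable H G → Avoidable H G′
avoidable-resp {H = H} {G′ = G′} G≈ (c , av) =
  c′ , avoiding-resp {c = c} {c′} G≈ (λ {u} {v} {x} {y} → mk⇔ id id) av
  where
  c′ : EdgeColouring G′
  c′ = record { colour = colour c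
              ; colour-sym = λ a → colour-sym c (subst T (sym (G≈ _ _)) a) }

module _ {n : ℕ} (c : Fin n → Fin n → ℕ) where

  private
    named? : ∀ x → Dec (∃[ u ] ∃[ v ] c u v ≡ x)
    named? x = any? λ u → any? λ v → c u v ℕ.≟ x

  -- A colour is renamed after an edge that bears it; zero is for unused colours.
  rename : ℕ → Fin (suc (n * n))
  rename x with named? x
  ... | yes (u , v , _) = suc (combine u v)
  ... | no _            = zero

  rename-injective : ∀ {u v x y} → rename (c u v) ≡ rename (c x y) → c u v ≡ c x y
  rename-injective {u} {v} {x} {y} eq with named? (c u v) | named? (c x y)
  ... | no ¬n | _     = contradiction (u , v , refl) ¬n
  ... | yes _ | no ¬n = contradiction (x , y , refl) ¬n
  ... | yes (i , j , p) | yes (k , l , q)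
    -- Equal names mean that both colours are borne by the one pair `i`, `j`.
    with refl , refl ← combine-injective i j k l (Fin.suc-injective eq) = trans (sym p) q

module _ {h n : ℕ} (H : Graph h) (G : Graph n) where

  private
    Symmetric : (Fin n → Fin n → Fin (suc (n * n))) → Set
    Symmetric d = ∀ u v → Adj G u v → d u v ≡ d v u

    colouring : Σ (Fin n → Fin n → Fin (suc (n * n))) Symmetric → EdgeColouring G
    colouring (d , d-sym) = record
      { colour = λ u v → toℕ (d u v) ; colour-sym = λ a → cong toℕ (d-sym _ _ a) }

  -- Renaming keeps the colour classes, so a palette of `suc (n * n)` colours suffices and the
  -- search runs over finitely many matrices.
  avoidable? : Dec (Avoidable H G)
  avoidable? =
    map′ (λ (d , av) → colouring d , av) compress
      (searchable-sub {matrixSetoid (Fin (suc (n * n))) n} {Symmetric}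
         (λ e s u v a → trans (sym (e u v)) (trans (s u v a) (e v u)))
         (λ d → all? λ u → all? λ v → T? (adj G u v) →-dec (d u v ≟ d v u))
         (searchable-matrix (searchable-Fin _) n)
         {λ d → Avoiding H (colouring d)}
         (λ {d} {d′} e → avoiding-resp {c = colouring d} {colouring d′} (λ _ _ → refl)
            λ {u} {v} {x} {y} → mk⇔
              (λ q → trans (cong toℕ (sym (e u v))) (trans q (cong toℕ (e x y))))
              (λ q → trans (cong toℕ (e u v)) (trans q (cong toℕ (sym (e x y))))))
         (λ d → proper? (colouring d) ×-dec ¬? (hasRainbowCopy? H (colouring d))))
    where
    compress : Avoidable H G → ∃[ d ] Avoiding H (colouring d)
    compress (c , av) = d , avoiding-resp {c = c} {colouring d} (λ _ _ → refl)
      (λ {u} {v} {x} {y} → mk⇔ (cong (toℕ ∘ rename (colour c)))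
                               (rename-injective (colour c) ∘ toℕ-injective)) av
      where d = (λ u v → rename (colour c) (colour c u v)) ,
                λ _ _ a → cong (rename (colour c)) (colour-sym c a)

addEdge-resp : ∀ {n} {G G′ : Graph n} {x y} (p q : x ≢ y) → G ≈ᴳ G′ → addEdge G x y p ≈ᴳ addEdge G′ x y q
addEdge-resp {x = x} {y} p q G≈ u v = cong (Data.Bool._∨ does (sameEdge? u v x y)) (G≈ u v)

module _ {h n : ℕ} {H : Graph h} where

  saturated-resp : {G G′ : Graph n} → G ≈ᴳ G′ →
                   ProperlyRainbowSaturated H G → ProperlyRainbowSaturated H G′
  saturated-resp {G} {G′} G≈ sat = record
    { avoidable = avoidable-resp {G = G} {G′} G≈ (ProperlyRainbowSaturated.avoidable sat)
    -- A colouring without a rainbow copy would transfer to the other graph and contradict its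
    -- saturation; decidability of rainbow copies turns this refutation into a copy.
    ; saturated = λ x y x≢y ¬a c proper → decidable-stable (hasRainbowCopy? H c) λ none →
        let c′ , p , none′ = avoidable-resp {G = addEdge G′ x y x≢y} {addEdge G x y x≢y}
                               (addEdge-resp {G = G′} {G} x≢y x≢y λ u v → sym (G≈ u v)) (c , proper , none)
        in none′ (ProperlyRainbowSaturated.saturated sat x y x≢y
                    (¬a ∘ subst T (G≈ x y)) c′ p)
    }

  -- Since the presence of a rainbow copy is decidable, condition (2) amounts to the absence of an
  -- avoiding colouring of each `addEdge G x y x≢y`, which `avoidable?` settles.
  saturated? : (G : Graph n) → Dec (ProperlyRainbowSaturated H G)
  saturated? G = map′ fwd bwd
    (avoidable? H G ×-dec all? λ x → all? λ y → unavoidable? x y)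
    where
    Unavoidable : Fin n → Fin n → Set
    Unavoidable x y = (x≢y : x ≢ y) → ¬ Adj G x y → ¬ Avoidable H (addEdge G x y x≢y)

    unavoidable? : ∀ x y → Dec (Unavoidable x y)
    unavoidable? x y with x ≟ y
    ... | yes x≡y = yes λ x≢y → contradiction x≡y x≢y
    ... | no x≢y = map′
      (λ un p ¬a → un ¬a ∘ avoidable-resp {G = addEdge G x y p} {addEdge G x y x≢y}
                             (addEdge-resp {G = G} {G} p x≢y λ _ _ → refl))
      (λ un → un x≢y)
      (¬? (T? (adj G x y)) →-dec ¬? (avoidable? H (addEdge G x y x≢y)))

    fwd : Avoidable H G × (∀ x y → Unavoidable x y) → ProperlyRainbowSaturated H G
    fwd (av , un) = record
      { avoidable = av
      ; saturated = λ x y x≢y ¬a c proper → decidable-stable (hasRainbowCopy? H c)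
          λ none → un x y x≢y ¬a (c , proper , none) }

    bwd : ProperlyRainbowSaturated H G → Avoidable H G × (∀ x y → Unavoidable x y)
    bwd sat = ProperlyRainbowSaturated.avoidable sat ,
      λ x y x≢y ¬a (c , proper , none) →
        none (ProperlyRainbowSaturated.saturated sat x y x≢y ¬a c proper)

orderedEdge? : ∀ {n} (G : Graph n) → Decidable λ ((u , v) : Fin n × Fin n) → u Fin.< v × Adj G u v
orderedEdge? G (u , v) = (u <? v) ×-dec T? (adj G u v)

edgeCount-resp : ∀ {n} {G G′ : Graph n} → G ≈ᴳ G′ → edgeCount G ≡ edgeCount G′
edgeCount-resp {n} {G} {G′} G≈ = cong length (filter-≐ (orderedEdge? G) (orderedEdge? G′)
  ( (λ { {u , v} (lt , a) → lt , subst T (G≈ u v) a })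
  , (λ { {u , v} (lt , a) → lt , subst T (sym (G≈ u v)) a }) )
  (cartesianProduct (allFin n) (allFin n)))

module _ {h : ℕ} (n : ℕ) (H : Graph h) where

  private
    IsAdjacency : (Fin n → Fin n → Bool) → Set
    IsAdjacency a = (∀ u v → a u v ≡ a v u) × (∀ u → a u u ≡ false)

    graph : Σ (Fin n → Fin n → Bool) IsAdjacency → Graph n
    graph (a , s , i) = record { adj = a ; adj-sym = s ; adj-irrefl = i }

    SaturatedOfSize : ℕ → Graph n → Set
    SaturatedOfSize s G = ProperlyRainbowSaturated H G × edgeCount G ≡ s

    saturatedOfSize? : ∀ s → Dec (∃ (SaturatedOfSize s))
    saturatedOfSize? s =
      map′ (λ (a , p) → graph a , p)
           (λ (G , p) → (adj G , adj-sym G , adj-irrefl G) , p)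
        (searchable-sub {matrixSetoid Bool n} {IsAdjacency}
          (λ e (s , i) → (λ u v → trans (sym (e u v)) (trans (s u v) (e v u))) ,
                         (λ u → trans (sym (e u u)) (i u)))
          (λ a → (all? λ u → all? λ v → a u v ≟ᵇ a v u) ×-dec (all? λ u → a u u ≟ᵇ false))
          (searchable-matrix searchable-Bool n)
          {λ a → SaturatedOfSize s (graph a)}
          (λ {a} {b} e (sat , count) →
             saturated-resp {G = graph a} {graph b} e sat ,
             trans (sym (edgeCount-resp {G = graph a} {graph b} e)) count)
          (λ a → saturated? (graph a) ×-dec (edgeCount (graph a) ℕ.≟ s)))

  -- The sizes of saturated graphs form a decidable set of numbers, inhabited by `edgeCount G`, and
  -- so have a least element.
  sat*-exists : {G : Graph n} → ProperlyRainbowSaturated H G →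
                ∃[ s ] (IsSat* n H s × s ≤ edgeCount G)
  sat*-exists {G} sat =
    let s , attained , minimal = least saturatedOfSize? (G , sat , refl)
    in s , record { attained = attained ; minimal = λ G′ sat′ → minimal (G′ , sat′ , refl) }
         , minimal (G , sat , refl)

-- Matchings, round-robin colourings and edge counts

-- Peel off the first row and column: they agree by symmetry, so apart from the zero corner they
-- contribute `2 * row`, and the minor is even by induction.
symmetric-sum-even : ∀ n (M : Fin n → Fin n → ℕ) → (∀ i j → M i j ≡ M j i) → (∀ i → M i i ≡ 0) →
                     2 ∣ sum λ i → sum (M i)
symmetric-sum-even zero    M M-sym M-diag = 2 ∣0
symmetric-sum-even (suc n) M M-sym M-diag =
  subst (2 ∣_) (sym split)
    (∣m∣n⇒∣m+n (m∣m*n row)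
      (symmetric-sum-even n _ (λ i j → M-sym (suc i) (suc j)) (M-diag ∘ suc)))
  where
  open ≡-Reasoning
  row = sum λ j → M zero (suc j)
  minor = sum λ i → sum λ j → M (suc i) (suc j)

  regroup : ∀ a b → a + (a + b) ≡ 2 * a + b
  regroup = solve-∀

  split : sum (λ i → sum (M i)) ≡ 2 * row + minor
  split = begin
    M zero zero + row + sum (λ i → M (suc i) zero + sum (λ j → M (suc i) (suc j)))
      ≡⟨ cong₂ (λ d → d + row +_) (M-diag zero) (∑-distrib-+ (λ i → M (suc i) zero) _) ⟩
    row + (sum (λ i → M (suc i) zero) + minor)
      ≡⟨ cong (λ r → row + (r + minor)) (sum-cong-≗ λ i → M-sym (suc i) zero) ⟩
    row + (row + minor)
      ≡⟨ regroup row minor ⟩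
    2 * row + minor ∎

indicator : Bool → ℕ
indicator b = if b then 1 else 0

sum-indicator-≟ : ∀ {n} (a : Fin n) → sum (λ j → indicator (does (a ≟ j))) ≡ 1
sum-indicator-≟ {suc n} zero    = cong suc (sum-replicate-zero n)
sum-indicator-≟ {suc n} (suc a) = sum-indicator-≟ a

sum-ones : ∀ n → sum {n} (λ _ → 1) ≡ n
sum-ones zero    = refl
sum-ones (suc n) = cong suc (sum-ones n)

-- The matrix of the involution is symmetric with zero diagonal and row sums 1.
fixpoint-free-involution⇒even : ∀ {n} (f : Fin n → Fin n) →
                                (∀ i → f (f i) ≡ i) → (∀ i → f i ≢ i) → 2 ∣ n
fixpoint-free-involution⇒even {n} f f-inv f-free =
  subst (2 ∣_) (trans (sum-cong-≗ (sum-indicator-≟ ∘ f)) (sum-ones n))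
    (symmetric-sum-even n (λ i j → indicator (does (f i ≟ j)))
      (λ i j → cong indicator (does-⇔ (mk⇔ (swap i j) (swap j i)) (f i ≟ j) (f j ≟ i)))
      (λ i → cong indicator (dec-false (f i ≟ i) (f-free i))))
  where
  swap : ∀ i j → f i ≡ j → f j ≡ i
  swap i j fi≡j = trans (cong f (sym fi≡j)) (f-inv i)

-- If every vertex were matched, sending each to its partner would be a fixpoint-free involution of
-- a set of odd size.
matching-misses-vertex : ∀ t (R : Fin (suc (2 * t)) → Fin (suc (2 * t)) → Set) →
  (∀ i j → Dec (R i j)) → (∀ {i j} → R i j → R j i) → (∀ {i} → ¬ R i i) →
  (∀ {i j l} → R i j → R i l → j ≡ l) → ∃[ v ] (∀ w → ¬ R v w)
matching-misses-vertex t R R? R-sym R-irrefl R-unique =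
  let v , ¬matched = ¬∀⟶∃¬ _ (λ i → ∃ (R i)) (λ i → any? (R? i)) not-perfect
  in v , λ w r → ¬matched (w , r)
  where
  even-odd : ¬ 2 ∣ suc (2 * t)
  even-odd d with () ← ∣1⇒≡1 (∣m+n∣m⇒∣n (subst (2 ∣_) (ℕ.+-comm 1 (2 * t)) d) (m∣m*n t))

  not-perfect : ¬ (∀ i → ∃ (R i))
  not-perfect matched = even-odd (fixpoint-free-involution⇒even (proj₁ ∘ matched)
    (λ i → R-unique (proj₂ (matched (proj₁ (matched i)))) (R-sym (proj₂ (matched i))))
    (λ i fi≡i → R-irrefl (subst (R i) fi≡i (proj₂ (matched i)))))

bounded-injective⇒≤ : ∀ {m n} (f : Fin m → ℕ) → (∀ i → f i < n) → Injective _≡_ _≡_ f → m ≤ n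
bounded-injective⇒≤ f f< f-inj =
  injective⇒≤ {f = λ i → fromℕ< (f< i)} (f-inj ∘ fromℕ<-injective _ _ (f< _) (f< _))

-- Adding `N ∸ i` modulo `N` recovers `a` from `(i + a) % N`.
+-%-cancelˡ : ∀ N .{{_ : ℕ.NonZero N}} i {a b} → i ≤ N → a < N → b < N → (i + a) % N ≡ (i + b) % N → a ≡ b
+-%-cancelˡ N i i≤N a<N b<N eq =
  trans (sym (shift-back a<N)) (trans (cong (λ x → ((N ∸ i) % N + x) % N) eq) (shift-back b<N))
  where
  open ≡-Reasoning
  shift-back : ∀ {a} → a < N → ((N ∸ i) % N + (i + a) % N) % N ≡ a
  shift-back {a} a<N = begin
    ((N ∸ i) % N + (i + a) % N) % N ≡⟨ %-distribˡ-+ (N ∸ i) (i + a) N ⟨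
    (N ∸ i + (i + a)) % N           ≡⟨ cong (_% N) (ℕ.+-assoc (N ∸ i) i a) ⟨
    (N ∸ i + i + a) % N             ≡⟨ cong (λ x → (x + a) % N) (ℕ.m∸n+n≡m i≤N) ⟩
    (N + a) % N                     ≡⟨ cong (_% N) (ℕ.+-comm N a) ⟩
    (a + N) % N                     ≡⟨ [m+n]%n≡m%n a N ⟩
    a % N                           ≡⟨ m<n⇒m%n≡m a<N ⟩
    a ∎

-- suc t is an inverse of 2 modulo suc (2 * t).
double-%-injective : ∀ t {a b} → let N = suc (2 * t) in
                     a < N → b < N → (a + a) % N ≡ (b + b) % N → a ≡ b
double-%-injective t a<N b<N eq =
  trans (sym (halve a<N)) (trans (cong (λ x → (suc t % N * x) % N) eq) (halve b<N))
  where
  open ≡-Reasoning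
  N = suc (2 * t)

  regroup : ∀ t a → suc t * (a + a) ≡ a + a * suc (2 * t)
  regroup = solve-∀

  halve : ∀ {a} → a < N → (suc t % N * ((a + a) % N)) % N ≡ a
  halve {a} a<N = begin
    (suc t % N * ((a + a) % N)) % N ≡⟨ %-distribˡ-* (suc t) (a + a) N ⟨
    (suc t * (a + a)) % N           ≡⟨ cong (_% N) (regroup t a) ⟩
    (a + a * N) % N                 ≡⟨ [m+kn]%n≡m%n a a N ⟩
    a % N                           ≡⟨ m<n⇒m%n≡m a<N ⟩
    a ∎

opaque
  -- The round-robin colouring of the complete graph on {0, …, N} with N = suc (2 * t)
  -- colours: i + j modulo N, where the vertex N ("infinity") stands for its neighbour.
  roundRobin : ℕ → ℕ → ℕ → ℕ
  roundRobin t i j with i ℕ.≟ suc (2 * t) | j ℕ.≟ suc (2 * t)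
  ... | yes _ | _     = (j + j) % suc (2 * t)
  ... | no _  | yes _ = (i + i) % suc (2 * t)
  ... | no _  | no _  = (i + j) % suc (2 * t)

  roundRobin-< : ∀ t i j → roundRobin t i j < suc (2 * t)
  roundRobin-< t i j with i ℕ.≟ suc (2 * t) | j ℕ.≟ suc (2 * t)
  ... | yes _ | _     = m%n<n (j + j) _
  ... | no _  | yes _ = m%n<n (i + i) _
  ... | no _  | no _  = m%n<n (i + j) _

  roundRobin-sym : ∀ t i j → roundRobin t i j ≡ roundRobin t j i
  roundRobin-sym t i j with i ℕ.≟ suc (2 * t) | j ℕ.≟ suc (2 * t)
  ... | yes refl | yes refl = refl
  ... | yes _    | no _     = refl
  ... | no _     | yes _    = refl
  ... | no _     | no _     = cong (_% suc (2 * t)) (ℕ.+-comm i j)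

  -- At a finite vertex `i` the colours are `i + j`, and the edge to infinity takes the value
  -- `i + i` that is left over. At infinity they are `j + j`, and doubling is injective modulo an
  -- odd number.
  roundRobin-injective : ∀ t {i j l} → let N = suc (2 * t) in i ≤ N → j ≤ N → l ≤ N → i ≢ j → i ≢ l →
                         roundRobin t i j ≡ roundRobin t i l → j ≡ l
  roundRobin-injective t {i} {j} {l} i≤N j≤N l≤N i≢j i≢l eq
    with i ℕ.≟ suc (2 * t) | j ℕ.≟ suc (2 * t) | l ℕ.≟ suc (2 * t)
  ... | yes refl | _ | _ = double-%-injective t (ℕ.≤∧≢⇒< j≤N (i≢j ∘ sym)) (ℕ.≤∧≢⇒< l≤N (i≢l ∘ sym)) eq
  ... | no _ | yes p | yes q = trans p (sym q)
  -- Here `j` is infinity, so its edge is coloured `i + i` and equality would force `l` to be `i`.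
  ... | no i≢N | yes _ | no l≢N =
    contradiction (+-%-cancelˡ _ i i≤N (ℕ.≤∧≢⇒< i≤N i≢N) (ℕ.≤∧≢⇒< l≤N l≢N) eq) i≢l
  ... | no i≢N | no j≢N | yes _ =
    contradiction (+-%-cancelˡ _ i i≤N (ℕ.≤∧≢⇒< i≤N i≢N) (ℕ.≤∧≢⇒< j≤N j≢N) (sym eq)) i≢j
  ... | no _ | no j≢N | no l≢N = +-%-cancelˡ _ i i≤N (ℕ.≤∧≢⇒< j≤N j≢N) (ℕ.≤∧≢⇒< l≤N l≢N) eq

-- Hits are confined to indices in the interval from `a` to `b`, exclusive of `b`. Dropping index
-- zero moves both bounds down by one, truncated at zero.
length-filter-tabulate : ∀ {A : Set} {P : A → Set} (P? : Decidable P) {n} (f : Fin n → A) {a b} →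
  (∀ i → P (f i) → a ≤ toℕ i × toℕ i < b) → length (filter P? (tabulate f)) ≤ b ∸ a
length-filter-tabulate P? {zero} f within = z≤n
length-filter-tabulate P? {suc n} f {a} {b} within with P? (f zero)
  | length-filter-tabulate P? (f ∘ suc) {ℕ.pred a} {ℕ.pred b} (λ i p →
      ℕ.pred-mono-≤ (proj₁ (within (suc i) p)) , ℕ.<⇒≤pred (proj₂ (within (suc i) p)))
... | no _  | tail = ≤-trans tail (shrink a b)
  where
  shrink : ∀ a b → ℕ.pred b ∸ ℕ.pred a ≤ b ∸ a
  shrink zero    b       = ℕ.pred[n]≤n
  shrink (suc a) zero    = ≤-reflexive (ℕ.0∸n≡0 a)
  shrink (suc a) (suc b) = ℕ.≤-refl
-- A hit at index zero forces `a` to be zero and `b` to be a successor, so the bound leaves room for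
-- one more.
... | yes p | tail with z≤n , s≤s _ ← within zero p = s≤s tail

-- The rows contribute at most `m ∸ 1`, `m ∸ 2`, and so on; by Pascal's rule these add up to at most
-- `m C 2`. Removing the first row replaces `m` by `m ∸ 1`.
length-filter-cartesianProduct : ∀ {A B : Set} {P : A × B → Set} (P? : Decidable P) {n}
  (f : Fin n → A) (ys : List B) m →
  (∀ i → length (filter P? (map (f i ,_) ys)) ≤ m ∸ suc (toℕ i)) →
  length (filter P? (cartesianProduct (tabulate f) ys)) ≤ m C 2
length-filter-cartesianProduct P? {zero} f ys m bound = z≤n
length-filter-cartesianProduct P? {suc n} f ys m bound = begin
  length (filter P? (row ++ rest))                 ≡⟨ cong length (filter-++ P? row rest) ⟩
  length (filter P? row ++ filter P? rest)         ≡⟨ length-++ (filter P? row) ⟩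
  length (filter P? row) + length (filter P? rest) ≤⟨ ℕ.+-mono-≤ (bound zero) rest-bound ⟩
  (m ∸ 1) + (m ∸ 1) C 2                            ≤⟨ pascal m ⟩
  m C 2                                            ∎
  where
  open ℕ.≤-Reasoning
  row = map (f zero ,_) ys
  rest = cartesianProduct (tabulate (f ∘ suc)) ys

  rest-bound : length (filter P? rest) ≤ (m ∸ 1) C 2
  rest-bound = length-filter-cartesianProduct P? (f ∘ suc) ys (m ∸ 1) λ i →
    ≤-trans (bound (suc i)) (≤-reflexive (sym (ℕ.∸-+-assoc m 1 (suc (toℕ i)))))

  pascal : ∀ m → (m ∸ 1) + (m ∸ 1) C 2 ≤ m C 2
  pascal zero    = z≤n
  pascal (suc m) = ≤-reflexive (trans (cong (_+ m C 2) (sym (nC1≡n m))) (nCk+nC[k+1]≡[n+1]C[k+1] m 1))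

n≤2*⌈n/2⌉ : ∀ n → n ≤ 2 * ⌈ n /2⌉
n≤2*⌈n/2⌉ n = begin
  n                     ≡⟨ ℕ.⌊n/2⌋+⌈n/2⌉≡n n ⟨
  ⌊ n /2⌋ + ⌈ n /2⌉     ≤⟨ ℕ.+-monoˡ-≤ ⌈ n /2⌉ (ℕ.⌊n/2⌋≤⌈n/2⌉ n) ⟩
  ⌈ n /2⌉ + ⌈ n /2⌉     ≡⟨ cong (⌈ n /2⌉ +_) (ℕ.+-identityʳ _) ⟨
  2 * ⌈ n /2⌉           ∎
  where open ℕ.≤-Reasoning

2*⌈n/2⌉≤1+n : ∀ n → 2 * ⌈ n /2⌉ ≤ suc n
2*⌈n/2⌉≤1+n n = begin
  2 * ⌈ n /2⌉               ≡⟨ cong (⌈ n /2⌉ +_) (ℕ.+-identityʳ _) ⟩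
  -- By definition `⌈ n /2⌉` is `⌊ suc n /2⌋`.
  ⌊ suc n /2⌋ + ⌊ suc n /2⌋ ≤⟨ ℕ.+-monoʳ-≤ ⌊ suc n /2⌋ (ℕ.⌊n/2⌋≤⌈n/2⌉ (suc n)) ⟩
  ⌊ suc n /2⌋ + ⌈ suc n /2⌉ ≡⟨ ℕ.⌊n/2⌋+⌈n/2⌉≡n (suc n) ⟩
  suc n                     ∎
  where open ℕ.≤-Reasoning

-- Rainbow copies of a star with an edge

T-does⁻ : ∀ {A : Set} (a? : Dec A) → T (does a?) → A
T-does⁻ (yes a) _ = a

T-does⁺ : ∀ {A : Set} (a? : Dec A) → A → T (does a?)
T-does⁺ (yes _) _ = tt
T-does⁺ (no ¬a) a = contradiction a ¬a

adj-swap : ∀ {n} (G : Graph n) {u v} → Adj G u v → Adj G v u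
adj-swap G = subst T (adj-sym G _ _)

adj⇒≢ : ∀ {n} (G : Graph n) {u v} → Adj G u v → u ≢ v
adj⇒≢ G a refl = subst T (adj-irrefl G _) a

module _ {A : Set} {k : ℕ} where

  -- The type `A` is left general because the values are vertices when a copy is built, but colours
  -- when the colours around a copy are counted.
  place : A → (Fin k → A) → A → A → Fin (1 + k) ⊎ Fin 2 → A
  place c ℓ a b (inj₁ zero)       = c
  place c ℓ a b (inj₁ (suc i))    = ℓ i
  place c ℓ a b (inj₂ zero)       = a
  place c ℓ a b (inj₂ (suc zero)) = b

  place-injective : ∀ {c ℓ a b} → Injective _≡_ _≡_ ℓ → (∀ i → c ≢ ℓ i) → c ≢ a → c ≢ b →
                    (∀ i → ℓ i ≢ a) → (∀ i → ℓ i ≢ b) → a ≢ b → Injective _≡_ _≡_ (place c ℓ a b)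
  place-injective {c} {ℓ} {a} {b} ℓ-inj c≢ℓ c≢a c≢b ℓ≢a ℓ≢b a≢b {s} {t} = go s t
    where
    go : ∀ s t → place c ℓ a b s ≡ place c ℓ a b t → s ≡ t
    go (inj₁ zero)       (inj₁ zero)       eq = refl
    go (inj₁ zero)       (inj₁ (suc i))    eq = contradiction eq (c≢ℓ i)
    go (inj₁ zero)       (inj₂ zero)       eq = contradiction eq c≢a
    go (inj₁ zero)       (inj₂ (suc zero)) eq = contradiction eq c≢b
    go (inj₁ (suc i))    (inj₁ zero)       eq = contradiction (sym eq) (c≢ℓ i)
    go (inj₁ (suc i))    (inj₁ (suc j))    eq = cong (inj₁ ∘ suc) (ℓ-inj eq)
    go (inj₁ (suc i))    (inj₂ zero)       eq = contradiction eq (ℓ≢a i)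
    go (inj₁ (suc i))    (inj₂ (suc zero)) eq = contradiction eq (ℓ≢b i)
    go (inj₂ zero)       (inj₁ zero)       eq = contradiction (sym eq) c≢a
    go (inj₂ zero)       (inj₁ (suc i))    eq = contradiction (sym eq) (ℓ≢a i)
    go (inj₂ zero)       (inj₂ zero)       eq = refl
    go (inj₂ zero)       (inj₂ (suc zero)) eq = contradiction eq a≢b
    go (inj₂ (suc zero)) (inj₁ zero)       eq = contradiction (sym eq) c≢b
    go (inj₂ (suc zero)) (inj₁ (suc i))    eq = contradiction (sym eq) (ℓ≢b i)
    go (inj₂ (suc zero)) (inj₂ zero)       eq = contradiction (sym eq) a≢b
    go (inj₂ (suc zero)) (inj₂ (suc zero)) eq = refl

splitAt-injective : ∀ m {n} → Injective _≡_ _≡_ (splitAt m {n})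
splitAt-injective m {n} {u} {v} eq =
  trans (sym (join-splitAt m n u)) (trans (cong (join m n) eq) (join-splitAt m n v))

centre : ∀ {k} → Fin (1 + k + 2)
centre = zero

leaf : ∀ {k} → Fin k → Fin (1 + k + 2)
leaf i = suc i ↑ˡ 2

end₁ end₂ : ∀ {k} → Fin (1 + k + 2)
end₁ {k} = (1 + k) ↑ʳ zero
end₂ {k} = (1 + k) ↑ʳ suc zero

leaf-injective : ∀ {k} → Injective _≡_ _≡_ (leaf {k})
leaf-injective eq = Fin.suc-injective (Fin.↑ˡ-injective 2 _ _ eq)

leaf≢end : ∀ {k} (i : Fin k) e → leaf i ≢ (1 + k) ↑ʳ e
leaf≢end {k} i e eq
  with () ← trans (sym (splitAt-↑ˡ (1 + k) (suc i) 2)) (trans (cong (splitAt (1 + k)) eq) (splitAt-↑ʳ (1 + k) 2 e))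

star-edge : ∀ {k} (i : Fin k) → Adj (star k ∪ complete 2) centre (leaf i)
star-edge {k} i rewrite splitAt-↑ˡ k i 2 = tt

pair-edge : ∀ {k} → Adj (star k ∪ complete 2) end₁ end₂
pair-edge {k} rewrite splitAt-↑ʳ k 2 zero | splitAt-↑ʳ k 2 (suc zero) = tt

-- Reduces claims about arbitrary adjacent pairs to the `k + 1` edges in a fixed orientation.
edge-view : ∀ {k u v} → Adj (star k ∪ complete 2) u v →
            (∃[ i ] SameEdge u v centre (leaf i)) ⊎ SameEdge u v end₁ end₂
edge-view {k} {u} {v} a with splitAt (1 + k) u in equ | splitAt (1 + k) v in eqv
... | inj₁ zero | inj₁ (suc i) = inj₁ (i , inj₁ (sym (splitAt⁻¹-↑ˡ equ) , sym (splitAt⁻¹-↑ˡ eqv)))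
... | inj₁ (suc i) | inj₁ zero = inj₁ (i , inj₂ (sym (splitAt⁻¹-↑ˡ equ) , sym (splitAt⁻¹-↑ˡ eqv)))
... | inj₂ zero | inj₂ (suc zero) = inj₂ (inj₁ (sym (splitAt⁻¹-↑ʳ {1 + k} equ) , sym (splitAt⁻¹-↑ʳ {1 + k} eqv)))
... | inj₂ (suc zero) | inj₂ (suc zero) with () ← a
... | inj₂ (suc zero) | inj₂ zero = inj₂ (inj₂ (sym (splitAt⁻¹-↑ʳ {1 + k} equ) , sym (splitAt⁻¹-↑ʳ {1 + k} eqv)))

sameEdge-sym : ∀ {n} {u v x y : Fin n} → SameEdge u v x y → SameEdge x y u v
sameEdge-sym (inj₁ (refl , refl)) = inj₁ (refl , refl)
sameEdge-sym (inj₂ (refl , refl)) = inj₂ (refl , refl)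

sameEdge-trans : ∀ {n} {u v x y a b : Fin n} → SameEdge u v x y → SameEdge x y a b → SameEdge u v a b
sameEdge-trans (inj₁ (refl , refl)) q                    = q
sameEdge-trans (inj₂ (refl , refl)) (inj₁ (refl , refl)) = inj₂ (refl , refl)
sameEdge-trans (inj₂ (refl , refl)) (inj₂ (refl , refl)) = inj₁ (refl , refl)

module _ {k n : ℕ} {G : Graph n} (c : EdgeColouring G) (proper : Proper c) where

  -- Properness at `v` already separates the star edges from one another, so only the colour of the
  -- edge from `a` to `b` has to be kept apart, by `fresh`.
  star∪edge⇒rainbow : ∀ {v a b} (ℓ : Fin k → Fin n) → Injective _≡_ _≡_ ℓ →
    (∀ i → Adj G v (ℓ i)) → Adj G a b → v ≢ a → v ≢ b → (∀ i → ℓ i ≢ a) → (∀ i → ℓ i ≢ b) →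
    (∀ i → colour c v (ℓ i) ≢ colour c a b) → HasRainbowCopy (star k ∪ complete 2) c
  star∪edge⇒rainbow {v} {a} {b} ℓ ℓ-inj vℓ ab v≢a v≢b ℓ≢a ℓ≢b fresh =
    record { embed = f ; injective = f-inj ; edge = λ {u} {w} → f-edge {u} {w} } ,
    λ {u} {w} {x} {y} → rainbow {u} {w} {x} {y}
    where
    H = star k ∪ complete 2

    f : Fin (1 + k + 2) → Fin n
    f = place v ℓ a b ∘ splitAt (1 + k)

    f-inj : Injective _≡_ _≡_ f
    f-inj = splitAt-injective (1 + k) ∘
            place-injective ℓ-inj (adj⇒≢ G ∘ vℓ) v≢a v≢b ℓ≢a ℓ≢b (adj⇒≢ G ab)

    f-leaf : ∀ i → f (leaf i) ≡ ℓ i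
    f-leaf i = cong (place v ℓ a b) (splitAt-↑ˡ (1 + k) (suc i) 2)

    f-end₁ : f end₁ ≡ a
    f-end₁ = cong (place v ℓ a b) (splitAt-↑ʳ (1 + k) 2 zero)

    f-end₂ : f end₂ ≡ b
    f-end₂ = cong (place v ℓ a b) (splitAt-↑ʳ (1 + k) 2 (suc zero))

    adj-image : ∀ {u w x y} → SameEdge u w x y → Adj G (f x) (f y) → Adj G (f u) (f w)
    adj-image (inj₁ (refl , refl)) e = e
    adj-image (inj₂ (refl , refl)) e = adj-swap G e

    colour-image : ∀ {u w x y} → SameEdge u w x y → Adj G (f x) (f y) →
                   colour c (f u) (f w) ≡ colour c (f x) (f y)
    colour-image (inj₁ (refl , refl)) e = refl
    colour-image (inj₂ (refl , refl)) e = sym (colour-sym c e)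

    f-star : ∀ i → Adj G (f centre) (f (leaf i))
    f-star i = subst (Adj G v) (sym (f-leaf i)) (vℓ i)

    f-pair : Adj G (f end₁) (f end₂)
    f-pair = subst₂ (Adj G) (sym f-end₁) (sym f-end₂) ab

    star-colour : ∀ {u w i} → SameEdge u w centre (leaf i) → colour c (f u) (f w) ≡ colour c v (ℓ i)
    star-colour {i = i} e = trans (colour-image e (f-star i)) (cong (colour c v) (f-leaf i))

    pair-colour : ∀ {u w} → SameEdge u w end₁ end₂ → colour c (f u) (f w) ≡ colour c a b
    pair-colour e = trans (colour-image e f-pair) (cong₂ (colour c) f-end₁ f-end₂)

    f-edge : ∀ {u w} → Adj H u w → Adj G (f u) (f w)
    f-edge {u} {w} e with edge-view {k} {u} {w} e
    ... | inj₁ (i , s) = adj-image s (f-star i)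
    ... | inj₂ s       = adj-image s f-pair

    rainbow : ∀ {u w x y} → Adj H u w → Adj H x y → ¬ SameEdge u w x y →
              colour c (f u) (f w) ≢ colour c (f x) (f y)
    rainbow {u} {w} {x} {y} d e ≁ eq with edge-view {k} {u} {w} d | edge-view {k} {x} {y} e
    ... | inj₁ (i , s) | inj₁ (j , t) =
      proper (vℓ i) (vℓ j)
        (λ ℓi≡ℓj → ≁ (sameEdge-trans s
          (subst (λ l → SameEdge centre (leaf l) x y) (sym (ℓ-inj ℓi≡ℓj)) (sameEdge-sym t))))
        (trans (sym (star-colour s)) (trans eq (star-colour t)))
    ... | inj₁ (i , s) | inj₂ t = fresh i (trans (sym (star-colour s)) (trans eq (pair-colour t)))
    ... | inj₂ s | inj₁ (i , t) = fresh i (trans (sym (star-colour t)) (trans (sym eq) (pair-colour s)))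
    ... | inj₂ s | inj₂ t       = ≁ (sameEdge-trans s (sameEdge-sym t))

  -- By properness the clique edges coloured like the edge from `x` to `y` form a matching `R`. A
  -- vertex that `R` misses serves as centre, and the other `2 * t` clique vertices supply the
  -- leaves.
  odd-clique∪edge⇒rainbow : ∀ {t x y} (q : Fin (suc (2 * t)) → Fin n) → k ≤ 2 * t → Injective _≡_ _≡_ q →
    (∀ {i j} → i ≢ j → Adj G (q i) (q j)) → Adj G x y → (∀ i → q i ≢ x) → (∀ i → q i ≢ y) →
    HasRainbowCopy (star k ∪ complete 2) c
  odd-clique∪edge⇒rainbow {t} {x} {y} q k≤2t q-inj clique xy q≢x q≢y =
    let v , free = matching-misses-vertex t R R? R-sym (λ r → proj₁ r refl) R-unique
        -- The first `k` of the `2 * t` indices other than `v`.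
        w = λ i → punchIn v (inject≤ i k≤2t)
        v≢w = λ i → punchInᵢ≢i v (inject≤ i k≤2t) ∘ sym
    in star∪edge⇒rainbow (q ∘ w)
         (λ eq → inject≤-injective k≤2t k≤2t _ _ (punchIn-injective v _ _ (q-inj eq)))
         (λ i → clique (v≢w i)) xy (q≢x v) (q≢y v) (q≢x ∘ w) (q≢y ∘ w)
         (λ i eq → free (w i) (v≢w i , eq))
    where
    R : Fin (suc (2 * t)) → Fin (suc (2 * t)) → Set
    R i j = i ≢ j × colour c (q i) (q j) ≡ colour c x y

    R? : ∀ i j → Dec (R i j)
    R? i j = ¬? (i ≟ j) ×-dec (colour c (q i) (q j) ℕ.≟ colour c x y)

    R-sym : ∀ {i j} → R i j → R j i
    R-sym (i≢j , eq) = i≢j ∘ sym , trans (colour-sym c (clique (i≢j ∘ sym))) eq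

    R-unique : ∀ {i j l} → R i j → R i l → j ≡ l
    R-unique {i} {j} {l} (i≢j , eq) (i≢l , eq′) with j ≟ l
    ... | yes j≡l = j≡l
    ... | no j≢l  = contradiction (trans eq (sym eq′)) (proper (clique i≢j) (clique i≢l) (j≢l ∘ q-inj))

-- Cliques with isolated vertices: edge count and saturation

module _ (m n : ℕ) where

  CliqueAdj : Fin n → Fin n → Set
  CliqueAdj u v = u ≢ v × toℕ u < m × toℕ v < m

  cliqueAdj? : ∀ u v → Dec (CliqueAdj u v)
  cliqueAdj? u v = ¬? (u ≟ v) ×-dec (toℕ u ℕ.<? m) ×-dec (toℕ v ℕ.<? m)

  opaque
    clique : Graph n
    clique = record
      { adj        = λ u v → does (cliqueAdj? u v)
      ; adj-sym    = λ u v → does-⇔ (mk⇔ flip flip) (cliqueAdj? u v) (cliqueAdj? v u)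
      ; adj-irrefl = λ u → dec-false (cliqueAdj? u u) λ (u≢u , _) → u≢u refl
      }
      where
      flip : ∀ {u v} → CliqueAdj u v → CliqueAdj v u
      flip (u≢v , u< , v<) = u≢v ∘ sym , v< , u<

    clique⁻ : ∀ {u v} → Adj clique u v → CliqueAdj u v
    clique⁻ = T-does⁻ (cliqueAdj? _ _)

    clique⁺ : ∀ {u v} → CliqueAdj u v → Adj clique u v
    clique⁺ = T-does⁺ (cliqueAdj? _ _)

  -- Row `i` keeps only the `j` with `i < j < m`, hence at most `m ∸ suc i` pairs.
  edgeCount-clique : edgeCount clique ≤ m C 2
  edgeCount-clique =
    length-filter-cartesianProduct (orderedEdge? clique) id (allFin n) m λ i →
      subst (λ xs → length (filter (orderedEdge? clique) xs) ≤ m ∸ suc (toℕ i)) (sym (map-tabulate id (i ,_)))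
        (length-filter-tabulate (orderedEdge? clique) (i ,_)
          λ j (i<j , a) → i<j , proj₂ (proj₂ (clique⁻ a)))

module _ (t n : ℕ) where

  private
    N : ℕ
    N = suc (2 * t)

    K : Graph n
    K = clique (suc N) n

    clique⇒≤ : ∀ {u v : Fin n} → Adj K u v → toℕ u ≤ N × toℕ v ≤ N
    clique⇒≤ a = let _ , u< , v< = clique⁻ (suc N) n a in ℕ.s≤s⁻¹ u< , ℕ.s≤s⁻¹ v<

  roundRobinColouring : EdgeColouring K
  roundRobinColouring = record
    { colour     = λ u v → roundRobin t (toℕ u) (toℕ v)
    ; colour-sym = λ _ → roundRobin-sym t _ _ }

  roundRobin-proper : Proper roundRobinColouring
  roundRobin-proper uv uw v≢w eq =
    v≢w (toℕ-injective (roundRobin-injective t (proj₁ (clique⇒≤ uv)) (proj₂ (clique⇒≤ uv)) (proj₂ (clique⇒≤ uw))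
      (adj⇒≢ K uv ∘ toℕ-injective) (adj⇒≢ K uw ∘ toℕ-injective) eq))

  -- The `k + 3` colours come from the edge `ab`, the star edges, and the clique edges `va` and `vb`
  -- outside the copy. Rainbowness separates `ab` from the star; every other two of these edges
  -- share a vertex, where properness applies.
  roundRobin-avoids : ∀ {k} → 1 ≤ k → N < k + 3 → ¬ HasRainbowCopy (star k ∪ complete 2) roundRobinColouring
  roundRobin-avoids {suc k′} _ N<k+3 (f , rainbow) =
    ℕ.<⇒≱ N<k+3 (subst (_≤ N) (sym (ℕ.+-suc k 2))
      (bounded-injective⇒≤ g (λ u → g-< (splitAt (1 + k) u)) (splitAt-injective (1 + k) ∘ g-inj)))
    where
    k = suc k′
    c = colour roundRobinColouring
    v = embed f (centre {k})
    ℓ = embed f ∘ leaf {k}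
    a = embed f (end₁ {k})
    b = embed f (end₂ {k})

    g : Fin (1 + k + 2) → ℕ
    -- Each vertex of the copy indexes one colour: the centre that of `ab`, every other vertex that
    -- of the edge joining its image to `v`.
    g = place (c a b) (c v ∘ ℓ) (c v a) (c v b) ∘ splitAt (1 + k)

    g-< : ∀ s → place (c a b) (c v ∘ ℓ) (c v a) (c v b) s < N
    g-< (inj₁ zero)       = roundRobin-< t _ _
    g-< (inj₁ (suc _))    = roundRobin-< t _ _
    g-< (inj₂ zero)       = roundRobin-< t _ _
    g-< (inj₂ (suc zero)) = roundRobin-< t _ _

    vℓ : ∀ i → Adj K v (ℓ i)
    vℓ i = edge f (star-edge i)

    ab : Adj K a b
    ab = edge f (pair-edge {k})

    ba = adj-swap K ab

    v≢a : v ≢ a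
    v≢a eq with () ← injective f eq

    v≢b : v ≢ b
    v≢b eq with () ← injective f eq

    -- As `k` is positive there is a leaf, whose edge shows that `v` lies in the clique.
    join-v : ∀ {u} → v ≢ u → ∀ {w} → Adj K u w → Adj K v u
    join-v v≢u uw = clique⁺ (suc N) n
      (v≢u , s≤s (proj₁ (clique⇒≤ (vℓ zero))) , s≤s (proj₁ (clique⇒≤ uw)))

    va = join-v v≢a ab
    vb = join-v v≢b ba

    c-sym : ∀ {u w} → c u w ≡ c w u
    c-sym = roundRobin-sym t _ _

    ≁ : ∀ i → ¬ SameEdge (end₁ {k}) (end₂ {k}) (centre {k}) (leaf i)
    ≁ i (inj₁ (() , _))
    ≁ i (inj₂ (_ , ()))

    g-inj : Injective _≡_ _≡_ (place (c a b) (c v ∘ ℓ) (c v a) (c v b))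
    g-inj = place-injective
      (λ {i} {j} eq → decidable-stable (i ≟ j) λ i≢j →
        roundRobin-proper (vℓ i) (vℓ j) (i≢j ∘ leaf-injective ∘ injective f) eq)
      (λ i → rainbow (pair-edge {k}) (star-edge i) (≁ i))
      (λ eq → roundRobin-proper ab (adj-swap K va) (v≢b ∘ sym) (trans eq c-sym))
      (λ eq → roundRobin-proper ba (adj-swap K vb) (v≢a ∘ sym) (trans c-sym (trans eq c-sym)))
      (λ i → roundRobin-proper (vℓ i) va (leaf≢end i zero ∘ injective f))
      (λ i → roundRobin-proper (vℓ i) vb (leaf≢end i (suc zero) ∘ injective f))
      (roundRobin-proper va vb (adj⇒≢ K ab))

  clique-saturated : ∀ {k} → 1 ≤ k → k ≤ 2 * t → N < k + 3 → suc N ≤ n →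
                     ProperlyRainbowSaturated (star k ∪ complete 2) K
  clique-saturated {k} 1≤k k≤2t N<k+3 1+N≤n = record
    { avoidable = roundRobinColouring , roundRobin-proper , roundRobin-avoids 1≤k N<k+3
    ; saturated = saturated
    }
    where
    saturated : ∀ x y (x≢y : x ≢ y) → ¬ Adj K x y → (c : EdgeColouring (addEdge K x y x≢y)) → Proper c →
                HasRainbowCopy (star k ∪ complete 2) c
    saturated x y x≢y ¬xy c proper =
      -- Omitting index `p` from the `suc N` clique vertices leaves an odd clique on `N` vertices
      -- that avoids both `x` and `y`.
      let p , avoids-x , avoids-y = hole
      in odd-clique∪edge⇒rainbow c proper {t} (ι ∘ punchIn p) k≤2t
           (punchIn-injective p _ _ ∘ inject≤-injective 1+N≤n 1+N≤n _ _)
           (λ i≢j → from T-∨ (inj₁ (clique⁺ (suc N) n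
             (i≢j ∘ punchIn-injective p _ _ ∘ inject≤-injective 1+N≤n 1+N≤n _ _ , ι< _ , ι< _))))
           (from (T-∨ {adj K x y}) (inj₂ (T-does⁺ (sameEdge? x y x y) (inj₁ (refl , refl)))))
           avoids-x avoids-y
      where
      ι : Fin (suc N) → Fin n
      ι i = inject≤ i 1+N≤n

      ι< : ∀ i → toℕ (ι i) < suc N
      ι< i = subst (_< suc N) (sym (toℕ-inject≤ i 1+N≤n)) (toℕ<n i)

      outside : ∀ {z} → ¬ toℕ z < suc N → ∀ i → ι i ≢ z
      outside z≮ i refl = z≮ (ι< i)

      dodge : ∀ z → ∃[ p ] (∀ i → ι (punchIn p i) ≢ z)
      dodge z with toℕ z ℕ.<? suc N
      -- Outside the clique `z` is avoided anyway, so the omitted index `zero` is an arbitrary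
      -- choice.
      ... | no z≮  = zero , λ i → outside z≮ _
      ... | yes z< = fromℕ< z< , λ i eq → punchInᵢ≢i (fromℕ< z<) i (toℕ-injective
        (trans (sym (toℕ-inject≤ _ 1+N≤n)) (trans (cong toℕ eq) (sym (toℕ-fromℕ< z<)))))

      hole : ∃[ p ] ((∀ i → ι (punchIn p i) ≢ x) × (∀ i → ι (punchIn p i) ≢ y))
      hole with toℕ x ℕ.<? suc N | toℕ y ℕ.<? suc N
      ... | yes x< | yes y< = contradiction (clique⁺ (suc N) n (x≢y , x< , y<)) ¬xy
      -- With `y` outside the clique, only `x` may have to be omitted.
      ... | _      | no y≮  = let p , avoids = dodge x in p , avoids , λ _ → outside y≮ _
      ... | no x≮  | yes _  = let p , avoids = dodge y in p , (λ _ → outside x≮ _) , avoids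

theorem4p3 : (k n : ℕ) → k ≥ 1 → n ≥ 2 * ⌈ k /2⌉ + 2 →
    ∃[ s ] (IsSat* n (star k ∪ complete 2) s × s ≤ (2 * ⌈ k /2⌉ + 2) C 2)
theorem4p3 k n k≥1 n≥ =
  -- With `t` equal to `⌈ k /2⌉`, the bound `k ≤ 2 * t` provides enough leaves, and `2 * t ≤ suc k`
  -- keeps the number of colours below `k + 3`.
  let s , isSat* , s≤ = sat*-exists n (star k ∪ complete 2)
        (clique-saturated ⌈ k /2⌉ n k≥1 (n≤2*⌈n/2⌉ k) N<k+3 (subst (_≤ n) m≡ n≥))
  in s , isSat* , ≤-trans s≤ (subst (λ m → edgeCount (clique (2 + 2 * ⌈ k /2⌉) n) ≤ m C 2) (sym m≡)
                               (edgeCount-clique (2 + 2 * ⌈ k /2⌉) n))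
  where
  m≡ : 2 * ⌈ k /2⌉ + 2 ≡ 2 + 2 * ⌈ k /2⌉
  m≡ = ℕ.+-comm (2 * ⌈ k /2⌉) 2

  N<k+3 : suc (2 * ⌈ k /2⌉) < k + 3
  N<k+3 = subst (suc (2 * ⌈ k /2⌉) <_) (ℕ.+-comm 3 k) (s≤s (s≤s (2*⌈n/2⌉≤1+n k)))
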